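{- Let $k,s\ge 1$ be integers and let $A_k=\{a_1=1<a_2<\dots<a_k\}$ be a set of $k$ positive integers. The Sliding window incremental LPSP algorithm (described in the context), on input $(A_k,s)$, is correct, i.e. it terminates and returns the $s$-range $n_s(A_k)$, and it requires $O(k\,s\,a_k)$ assignments, or more precisely $O\bigl(k\,n_s(A_k)+a_k\bigr)$ assignments.
   Context: For positive integers $s,k$ and a set (basis) $A_k=\{a_1<a_2<\dots<a_k\}$ of $k$ distinct positive integers, the $s$-range $n_s(A_k)$ is the largest integer $n\ge 0$ such that for every integer $0\le i\le n$ there exists $(\lambda_1,\dots,\lambda_k)\in\mathbb{N}^k$ (with $0\in\mathbb N$) satisfying $\sum_{j=1}^k\lambda_j\le s$ and $i=\sum_{j=1}^k\lambda_j a_j$. The local postage stamp problem (LPSP) is the determination of $n_s(A_k)$ given $s$ and $A_k$. Sliding window incremental LPSP algorithm. Input: a basis $A_k=\{a_1=1<a_2<\dots<a_k\}$ and a number of stamps $s$. 1. Set $l\leftarrow\lceil\log_2(a_k+1)\rceil$ and $w\leftarrow 2^l-1$. Below, $x\mathbin{\&}w$ denotes the bitwise "and" of $x$ and $w$, i.e. $x \bmod 2^l$. 2. Create two arrays indexed by $0,\dots,2^l-1$: $T\leftarrow[0,s+1,s+1,\dots,s+1]\in\mathbb{N}^{2^l}$ (so $T[0]=0$ and all other entries are $s+1$) and $U\leftarrow[1,1,\dots,1]\in\mathbb{N}^{2^l}$. Set $i\leftarrow 0$. 3. Repeat the following (a)–(c): (a) for $j$ from $U[i\mathbin{\&}w]$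 to $k$: if $T[(i+a_j)\mathbin{\&}w]>T[i\mathbin{\&}w]+1$, then set $T[(i+a_j)\mathbin{\&}w]\leftarrow T[i\mathbin{\&}w]+1$ and $U[(i+a_j)\mathbin{\&}w]\leftarrow j$; (b) set $T[i\mathbin{\&}w]\leftarrow s+1$; (c) set $i\leftarrow i+1$; until $T[i\mathbin{\&}w]>s$. 4. Return $i-1$. Cost is measured in number of assignments, i.e. writes to cells of the arrays, including their initialization. -}

module Defs where

open import Data.Bool using (if_then_else_)
open import Data.Fin as Fin using (Fin; zero; suc; fromℕ)
import Data.Fin.Properties as Fin
open import Data.List as List using (List)
open import Data.Nat using (ℕ; zero; suc; _+_; _*_; _∸_; _^_; _≤_; _<_; _>_; _>?_; NonZero)
open import Data.Nat.DivMod using (_mod_)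
open import Data.Nat.Logarithm using (⌈log₂_⌉)
open import Data.Nat.Properties using (m^n≢0)
open import Data.Product using (_×_; ∃-syntax)
open import Data.Vec as Vec using (Vec; lookup; replicate; zipWith; _[_]≔_)
open import Relation.Binary.PropositionalEquality using (_≡_)
open import Relation.Nullary.Decidable using (does)

-- The paper's index j ∈ {1,…,k} is the element j - 1 of Fin k.
first : ∀ {k} .{{_ : NonZero k}} → Fin k
first {suc _} = zero

last : ∀ {k} .{{_ : NonZero k}} → Fin k
last {suc k} = fromℕ k

record Basis (k : ℕ) : Set where
  field
    elements   : Vec ℕ k
    positive   : ∀ j → 0 < lookup elements j
    increasing : ∀ {i j} → i Fin.< j → lookup elements i < lookup elements j

  a : Fin k → ℕ
  a = lookup elements

min-element max-element : ∀ {k} .{{_ : NonZero k}} → Basis k → ℕ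
min-element A = Basis.a A first
max-element A = Basis.a A last

Representable : ∀ {k} → ℕ → Basis k → ℕ → Set
Representable {k} s A i =
  ∃[ λs ] (Vec.sum {k} λs ≤ s × i ≡ Vec.sum (zipWith _*_ λs (Basis.elements A)))

AllRepresentable : ∀ {k} → ℕ → Basis k → ℕ → Set
AllRepresentable s A n = ∀ i → i ≤ n → Representable s A i

-- IsRange s A n says n = n_s(A).
IsRange : ∀ {k} → ℕ → Basis k → ℕ → Set
IsRange s A n = AllRepresentable s A n × (∀ m → AllRepresentable s A m → m ≤ n)

module SlidingWindow {k : ℕ} .{{_ : NonZero k}} (A : Basis k) (s : ℕ) where
  open Basis A using (a)

  l : ℕ
  l = ⌈log₂ (max-element A + 1) ⌉

  size : ℕ
  size = 2 ^ l

  -- The bitwise "and" with w = 2 ^ l - 1 is reduction modulo 2 ^ l.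
  _&w : ℕ → Fin size
  x &w = _mod_ x size {{m^n≢0 2 l}}

  -- The variables of the program, with a counter of the array writes made.
  record State : Set where
    constructor state
    field
      T           : Vec ℕ size
      U           : Vec (Fin k) size
      i           : ℕ
      assignments : ℕ

    T[_] : ℕ → ℕ
    T[ x ] = lookup T (x &w)

    U[_] : ℕ → Fin k
    U[ x ] = lookup U (x &w)

  open State

  writeT : ℕ → ℕ → State → State
  writeT x v (state T U i c) = state (T [ x &w ]≔ v) U i (suc c)

  writeU : ℕ → Fin k → State → State
  writeU x j (state T U i c) = state T (U [ x &w ]≔ j) i (suc c)

  increment : State → State
  increment (state T U i c) = state T U (suc i) c

  -- Creating each array costs one assignment per cell.
  initial : State
  initial = state (replicate size (s + 1) [ 0 &w ]≔ 0) (replicate size first) 0 (size + size)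

  relax : State → Fin k → State
  relax σ j =
    if does (T[ σ ] (i σ + a j) >? T[ σ ] (i σ) + 1)
    then writeU (i σ + a j) j (writeT (i σ + a j) (T[ σ ] (i σ) + 1) σ)
    else σ

  indicesFrom : Fin k → List (Fin k)
  indicesFrom u = List.filter (u Fin.≤?_) (List.allFin k)

  scan : State → State
  scan σ = List.foldl relax σ (indicesFrom (U[ σ ] (i σ)))

  clear : State → State
  clear σ = writeT (i σ) (s + 1) σ

  body : State → State
  body σ = increment (clear (scan σ))

  -- σ ⇓ τ: the loop "repeat body until T[i & w] > s", entered in state σ,
  -- terminates in state τ.
  data _⇓_ (σ : State) : State → Set where
    exit   : T[ body σ ] (i (body σ)) > s → σ ⇓ body σ
    repeat : ∀ {τ} → T[ body σ ] (i (body σ)) ≤ s → body σ ⇓ τ → σ ⇓ τ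

  -- The algorithm terminates, returning n after c assignments.  The truncated
  -- subtraction is exact, since the body of the loop runs at least once.
  Returns_After_Assignments : ℕ → ℕ → Set
  Returns n After c Assignments =
    ∃[ τ ] (initial ⇓ τ × n ≡ i τ ∸ 1 × c ≡ assignments τ)

{-# OPTIONS --safe #-}

-- When the loop reaches i, T[i] is the least number of stamps of sum i.  The
-- entries that are written always count the stamps of an actual sum.  Conversely
-- T[x] ≤ suc t holds for every x = y + a j with y < i and y a sum of t stamps,
-- although the scan of y skips the indices j below u = U[y]: u is the last stamp
-- of an optimal sum for y, so y = z + a u gives y + a j = (z + a j) + a u, and
-- z + a j < y was scanned before.  Sums of at most s stamps are at most s * a_k,
-- which bounds the number n + 1 of rounds; each of them costs at most 2 k + 1
-- writes, and each array has at most 2 a_k cells.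

module Submission where

open import Data.Bool using (if_then_else_)
open import Data.Fin as Fin using (Fin; zero; suc; fromℕ; toℕ; inject₁)
import Data.Fin.Properties as Fin
open import Data.Fin.Induction using (<-weakInduction)
open import Data.List as List using (List; []; _∷_; length)
open import Data.List.Membership.Propositional using (_∈_)
open import Data.List.Membership.Propositional.Properties using (∈-filter⁺; ∈-allFin)
open import Data.List.Properties using (length-filter; length-tabulate)
open import Data.List.Relation.Unary.Any using (here; there)
open import Data.Nat using (ℕ; zero; suc; _+_; _*_; _^_; _≤_; _<_; _>_; _>?_; _≤?_; z≤n; s≤s; ⌊_/2⌋; ⌈_/2⌉; NonZero; >-nonZero⁻¹)
open import Data.Nat.DivMod using (_mod_; _/_; _%_; m≡m%n+[m/n]*n; m%n<n; [m+n]%n≡m%n; /-monoˡ-≤)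
open import Data.Nat.Logarithm using (⌈log₂_⌉)
open import Data.Nat.Logarithm.Core using (⌈log2⌉)
open import Data.Nat.Induction using (<-wellFounded)
open import Data.Nat.Properties
open import Data.Nat.Tactic.RingSolver using (solve-∀)
open import Data.Product using (_×_; ∃-syntax; _,_; proj₁)
open import Data.Sum using (inj₁; inj₂)
open import Data.Vec as Vec using (Vec; []; _∷_; lookup; replicate; zipWith; updateAt)
open import Data.Vec.Properties using (lookup∘update; lookup∘update′; lookup-replicate)
open import Function using (_∘_)
open import Induction.WellFounded using (Acc; acc)
open import Relation.Binary.PropositionalEquality
open import Relation.Nullary using (¬_; Dec; yes; no; contradiction; does)
open import Defs

-- Size of the arrays: bounds on the rounded power of two.

-- Induction along the recursion of `⌈log2⌉`, which passes from `2 + n` to `suc ⌈ n /2⌉`; hence the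
-- arbitrary accessibility proof.
n<2^⌈log2⌉[1+n] : ∀ n (rec : Acc _<_ (suc n)) → n < 2 ^ ⌈log2⌉ (suc n) rec
n<2^⌈log2⌉[1+n] zero    _        = s≤s z≤n
n<2^⌈log2⌉[1+n] (suc n) (acc rs) = begin
  2 + n                     ≡⟨ cong (2 +_) (⌊n/2⌋+⌈n/2⌉≡n n) ⟨
  2 + (⌊ n /2⌋ + ⌈ n /2⌉)   ≤⟨ +-monoʳ-≤ 2 (+-monoˡ-≤ ⌈ n /2⌉ (⌊n/2⌋≤⌈n/2⌉ n)) ⟩
  2 + (⌈ n /2⌉ + ⌈ n /2⌉)   ≡⟨ 2+[m+m]≡2*[1+m] ⌈ n /2⌉ ⟩
  2 * suc ⌈ n /2⌉           ≤⟨ *-monoʳ-≤ 2 (n<2^⌈log2⌉[1+n] ⌈ n /2⌉ (rs (⌈n/2⌉<n n))) ⟩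
  2 ^ ⌈log2⌉ (2 + n) (acc rs) ∎
  where
  open ≤-Reasoning
  2+[m+m]≡2*[1+m] : ∀ m → 2 + (m + m) ≡ 2 * suc m
  2+[m+m]≡2*[1+m] = solve-∀

-- The bound fails for the logarithm of 1, hence the form `2 + n`. The recursion keeps this form
-- because `⌈ suc n /2⌉` computes to `suc ⌊ n /2⌋`.
2^⌈log2⌉[2+n]≤2*[1+n] : ∀ n (rec : Acc _<_ (2 + n)) → 2 ^ ⌈log2⌉ (2 + n) rec ≤ 2 * suc n
2^⌈log2⌉[2+n]≤2*[1+n] zero    (acc rs) = ≤-refl
2^⌈log2⌉[2+n]≤2*[1+n] (suc n) (acc rs) = *-monoʳ-≤ 2 (begin
  2 ^ ⌈log2⌉ (2 + ⌊ n /2⌋) (rs (⌈n/2⌉<n (suc n)))  ≤⟨ 2^⌈log2⌉[2+n]≤2*[1+n] ⌊ n /2⌋ (rs (⌈n/2⌉<n (suc n))) ⟩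
  2 * suc ⌊ n /2⌋             ≡⟨ 2*[1+m]≡2+[m+m] ⌊ n /2⌋ ⟩
  2 + (⌊ n /2⌋ + ⌊ n /2⌋)     ≤⟨ +-monoʳ-≤ 2 (+-monoʳ-≤ ⌊ n /2⌋ (⌊n/2⌋≤⌈n/2⌉ n)) ⟩
  2 + (⌊ n /2⌋ + ⌈ n /2⌉)     ≡⟨ cong (2 +_) (⌊n/2⌋+⌈n/2⌉≡n n) ⟩
  2 + n                       ∎)
  where
  open ≤-Reasoning
  2*[1+m]≡2+[m+m] : ∀ m → 2 * suc m ≡ 2 + (m + m)
  2*[1+m]≡2+[m+m] = solve-∀

m<2^⌈log₂[m+1]⌉ : ∀ m → m < 2 ^ ⌈log₂ (m + 1) ⌉
m<2^⌈log₂[m+1]⌉ m =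
  subst (λ n → m < 2 ^ ⌈log₂ n ⌉) (+-comm 1 m) (n<2^⌈log2⌉[1+n] m (<-wellFounded (suc m)))

2^⌈log₂[m+1]⌉≤2*m : ∀ {m} → 0 < m → 2 ^ ⌈log₂ (m + 1) ⌉ ≤ 2 * m
2^⌈log₂[m+1]⌉≤2*m {suc n} _ =
  subst (λ m → 2 ^ ⌈log₂ m ⌉ ≤ 2 * suc n) (+-comm 1 (suc n)) (2^⌈log2⌉[2+n]≤2*[1+n] n (<-wellFounded (2 + n)))

-- Residues within a window of length `o`.

-- With equal remainders, `n < m + o` forces `n / o < suc (m / o)`, while `m ≤ n` gives the converse
-- bound, so the quotients agree too.
%-injective-window : ∀ {m n o} .{{_ : NonZero o}} → m ≤ n → n < m + o → m % o ≡ n % o → m ≡ n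
%-injective-window {m} {n} {o} m≤n n<m+o eq = begin-equality
  m                    ≡⟨ m≡m%n+[m/n]*n m o ⟩
  m % o + (m / o) * o  ≡⟨ cong₂ (λ r q → r + q * o) eq (≤-antisym (/-monoˡ-≤ o m≤n) (≤-pred n/o<1+m/o)) ⟩
  n % o + (n / o) * o  ≡⟨ m≡m%n+[m/n]*n n o ⟨
  n                    ∎
  where
  open ≤-Reasoning
  n/o<1+m/o : n / o < suc (m / o)
  n/o<1+m/o = *-cancelʳ-< o (n / o) (suc (m / o)) (+-cancelˡ-< (n % o) _ _ (begin-strict
    n % o + (n / o) * o        ≡⟨ m≡m%n+[m/n]*n n o ⟨
    n                          <⟨ n<m+o ⟩
    m + o                      ≡⟨ cong (_+ o) (m≡m%n+[m/n]*n m o) ⟩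
    m % o + (m / o) * o + o    ≡⟨ cong (λ r → r + (m / o) * o + o) eq ⟩
    n % o + (m / o) * o + o    ≡⟨ +-assoc (n % o) _ o ⟩
    n % o + ((m / o) * o + o)  ≡⟨ cong (n % o +_) (+-comm ((m / o) * o) o) ⟩
    n % o + suc (m / o) * o    ∎))

mod-injective-window : ∀ b {m n o} .{{_ : NonZero o}} → b ≤ m → m < b + o → b ≤ n → n < b + o →
                       m mod o ≡ n mod o → m ≡ n
mod-injective-window b {m} {n} {o} b≤m m<b+o b≤n n<b+o eq with ≤-total m n
... | inj₁ m≤n = %-injective-window m≤n (<-≤-trans n<b+o (+-monoˡ-≤ o b≤m)) %-eq
  where %-eq = Fin.fromℕ<-injective _ _ (m%n<n m o) (m%n<n n o) eq
... | inj₂ n≤m = sym (%-injective-window n≤m (<-≤-trans m<b+o (+-monoˡ-≤ o b≤n)) (sym %-eq))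
  where %-eq = Fin.fromℕ<-injective _ _ (m%n<n m o) (m%n<n n o) eq

if-elim : ∀ {A P : Set} (Q : A → Set) {x y : A} (p? : Dec P) →
          (P → Q x) → (¬ P → Q y) → Q (if does p? then x else y)
if-elim Q (yes p) f g = f p
if-elim Q (no ¬p) f g = g ¬p

≮first : ∀ {k} .{{_ : NonZero k}} {j : Fin k} → ¬ (j Fin.< first)
≮first {suc _} ()

j≤last : ∀ {k} .{{_ : NonZero k}} (j : Fin k) → j Fin.≤ last
j≤last {suc _} = Fin.≤fromℕ

-- Sums of stamps, as sequences and as coefficient vectors.

private variable
  k t x : ℕ

-- Stamps are added one at a time, as the algorithm does, so that a nonempty sum has a last stamp;
-- `t` is their exact number, not a bound.
data Reach (v : Vec ℕ k) : ℕ → ℕ → Set where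
  none : Reach v 0 0
  add  : Reach v t x → ∀ j → Reach v (suc t) (x + lookup v j)

_∙_ : Vec ℕ k → Vec ℕ k → ℕ
λs ∙ v = Vec.sum (zipWith _*_ λs v)

0∙v≡0 : (v : Vec ℕ k) → replicate k 0 ∙ v ≡ 0
0∙v≡0 []      = refl
0∙v≡0 (_ ∷ v) = 0∙v≡0 v

sum-replicate-0 : ∀ k → Vec.sum (replicate k 0) ≡ 0
sum-replicate-0 zero    = refl
sum-replicate-0 (suc k) = sum-replicate-0 k

sum-updateAt-suc : (λs : Vec ℕ k) (j : Fin k) → Vec.sum (updateAt λs j suc) ≡ suc (Vec.sum λs)
sum-updateAt-suc (l ∷ λs) zero    = refl
sum-updateAt-suc (l ∷ λs) (suc j) = trans (cong (l +_) (sum-updateAt-suc λs j)) (+-suc l _)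

∙-updateAt-suc : (λs v : Vec ℕ k) (j : Fin k) → updateAt λs j suc ∙ v ≡ λs ∙ v + lookup v j
∙-updateAt-suc (l ∷ λs) (y ∷ v) zero    = lemma y (l * y) (λs ∙ v)
  where
  lemma : ∀ p q r → p + q + r ≡ q + r + p
  lemma = solve-∀
∙-updateAt-suc (l ∷ λs) (y ∷ v) (suc j) =
  trans (cong (l * y +_) (∙-updateAt-suc λs v j)) (sym (+-assoc (l * y) _ _))

Reach⇒∙ : ∀ {v : Vec ℕ k} → Reach v t x → ∃[ λs ] (Vec.sum λs ≡ t × x ≡ λs ∙ v)
Reach⇒∙ {k = k} {v = v} none = replicate k 0 , sum-replicate-0 k , sym (0∙v≡0 v)
Reach⇒∙ {v = v} (add r j) with λs , refl , refl ← Reach⇒∙ r =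
  updateAt λs j suc , sum-updateAt-suc λs j , sym (∙-updateAt-suc λs v j)

Reach-∷ : ∀ {v : Vec ℕ k} {y} → Reach v t x → Reach (y ∷ v) t x
Reach-∷ none      = none
Reach-∷ (add r j) = add (Reach-∷ r) (suc j)

add-copies : ∀ {v : Vec ℕ k} {y} n → Reach (y ∷ v) t x → Reach (y ∷ v) (n + t) (n * y + x)
add-copies zero r = r
add-copies {x = x} {y = y} (suc n) r = subst (Reach _ _) (lemma (n * y) x y) (add (add-copies n r) zero)
  where
  lemma : ∀ p q r → p + q + r ≡ r + p + q
  lemma = solve-∀

∙⇒Reach : (λs v : Vec ℕ k) → Reach v (Vec.sum λs) (λs ∙ v)
∙⇒Reach []       []      = none
∙⇒Reach (l ∷ λs) (_ ∷ v) = add-copies l (Reach-∷ (∙⇒Reach λs v))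

module _ {k : ℕ} (A : Basis k) where
  open Basis A

  Reach⇒Representable : ∀ {s} → Reach elements t x → t ≤ s → Representable s A x
  Reach⇒Representable r t≤s with λs , refl , eq ← Reach⇒∙ r = λs , t≤s , eq

  Representable⇒Reach : ∀ {s} → Representable s A x → ∃[ t ] (t ≤ s × Reach elements t x)
  Representable⇒Reach (λs , sum≤s , refl) = _ , sum≤s , ∙⇒Reach λs elements

-- Bounds in terms of the largest element.

module _ {k : ℕ} .{{_ : NonZero k}} (A : Basis k) where
  open Basis A

  a≤max-element : ∀ j → a j ≤ max-element A
  a≤max-element j with m≤n⇒m<n∨m≡n (j≤last j)
  ... | inj₁ j<last = <⇒≤ (increasing j<last)
  ... | inj₂ j≡last = ≤-reflexive (cong a (Fin.toℕ-injective j≡last))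

  Reach⇒≤ : Reach elements t x → x ≤ t * max-element A
  Reach⇒≤ none = z≤n
  Reach⇒≤ {suc t} (add r j) = ≤-trans (+-mono-≤ (Reach⇒≤ r) (a≤max-element j))
                                     (≤-reflexive (+-comm (t * max-element A) _))

-- Positive and strictly increasing elements exceed their 0-based index. This later absorbs the cost
-- of the one round beyond `n`.
k≤max-element : ∀ {k} .{{_ : NonZero k}} (A : Basis k) → k ≤ max-element A
k≤max-element {suc k} A =
  subst (_< max-element A) (Fin.toℕ-fromℕ k)
    (<-weakInduction (λ j → toℕ j < a j) (positive zero) step (fromℕ k))
  where
  open Basis A
  step : ∀ j → toℕ (inject₁ j) < a (inject₁ j) → toℕ (suc j) < a (suc j)
  step j ih rewrite Fin.toℕ-inject₁ j =
    ≤-<-trans ih (increasing (s≤s (≤-reflexive (Fin.toℕ-inject₁ j))))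

-- Cells of the circular arrays as integers of the current window.

module Correctness {k : ℕ} .{{_ : NonZero k}} (A : Basis k) (s : ℕ) where
  open Basis A
  open SlidingWindow A s
  open State

  instance
    size≢0 : NonZero size
    size≢0 = m^n≢0 2 l

  max-element<size : max-element A < size
  max-element<size = m<2^⌈log₂[m+1]⌉ (max-element A)

  i+a<i+size : ∀ i j → i + a j < i + size
  i+a<i+size i j = +-monoʳ-< i (≤-<-trans (a≤max-element A j) max-element<size)

  i<i+a : ∀ i j → i < i + a j
  i<i+a i j = m<m+n i (positive j)

  &w-injective : ∀ i {x y} → i ≤ x → x < i + size → i ≤ y → y < i + size → x &w ≡ y &w → x ≡ y
  &w-injective i = mod-injective-window i

  -- The cell given up by `i` is the one that serves `i + size` once the window moves.
  [i+size]&w≡i&w : ∀ i → i &w ≡ (i + size) &w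
  [i+size]&w≡i&w i = Fin.fromℕ<-cong _ _ (sym ([m+n]%n≡m%n i size)) (m%n<n i size) (m%n<n (i + size) size)

  T-writeT-≡ : ∀ σ {x y} v → x &w ≡ y &w → T[ writeT x v σ ] y ≡ v
  T-writeT-≡ σ {x} v eq = trans (cong (lookup (T (writeT x v σ))) (sym eq)) (lookup∘update (x &w) (T σ) v)

  T-writeT-≢ : ∀ σ {x y} v → x &w ≢ y &w → T[ writeT x v σ ] y ≡ T[ σ ] y
  T-writeT-≢ σ v neq = lookup∘update′ (neq ∘ sym) (T σ) v

  U-writeU-≡ : ∀ σ {x y} j → x &w ≡ y &w → U[ writeU x j σ ] y ≡ j
  U-writeU-≡ σ {x} j eq = trans (cong (lookup (U (writeU x j σ))) (sym eq)) (lookup∘update (x &w) (U σ) j)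

  U-writeU-≢ : ∀ σ {x y} j → x &w ≢ y &w → U[ writeU x j σ ] y ≡ U[ σ ] y
  U-writeU-≢ σ j neq = lookup∘update′ (neq ∘ sym) (U σ) j

  -- Sums with a recorded last stamp, and the exchange of stamps.

  -- The meaning of an entry of `U`. The empty sum gets `first`, the initial content of `U`, from
  -- which a scan skips nothing.
  data EndsWith : Fin k → ℕ → ℕ → Set where
    none : EndsWith first 0 0
    add  : ∀ {t x} → Reach elements t x → ∀ j → EndsWith j (suc t) (x + a j)

  -- The sums that the rounds before `n` have to account for: their last stamp is added to a value
  -- below `n`.
  data Candidate (n : ℕ) : ℕ → ℕ → Set where
    none : Candidate n 0 0
    add  : ∀ {t x} → x < n → Reach elements t x → ∀ j → Candidate n (suc t) (x + a j)

  EndsWith⇒Reach : ∀ {u t x} → EndsWith u t x → Reach elements t x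
  EndsWith⇒Reach none      = none
  EndsWith⇒Reach (add r j) = add r j

  -- Stamps are positive, so removing the last one leads below `x`. Thus all sums for `x` are
  -- accounted for when the loop arrives there.
  Reach⇒Candidate : ∀ {t x} → Reach elements t x → Candidate x t x
  Reach⇒Candidate none      = none
  Reach⇒Candidate (add r j) = add (i<i+a _ j) r j

  -- The stamp j is exchanged with the last stamp u.
  skipped-Candidate : ∀ {u t x j} → EndsWith u t x → j Fin.< u → Candidate x (suc t) (x + a j)
  skipped-Candidate none j<first = contradiction j<first ≮first
  skipped-Candidate {j = j} (add {x = z} r u) j<u =
    subst (Candidate _ _) (lemma z (a j) (a u)) (add (+-monoʳ-< z (increasing j<u)) (add r j) u)
    where
    lemma : ∀ p q r → p + q + r ≡ p + r + q
    lemma = solve-∀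

  -- Effect of a scan on the state.

  -- Only entries at most `s` claim a sum, since `s + 1` marks an empty cell.
  Sound : State → Set
  Sound σ = ∀ x → i σ ≤ x → x < i σ + size → T[ σ ] x ≤ s → EndsWith (U[ σ ] x) (T[ σ ] x) x

  -- A summary of relaxing the indices `js` that composes along the fold: `T-head` lets every step
  -- refer to the same value at `i σ`, and `T-≤` preserves upper bounds established earlier.
  record Scanned (σ σ′ : State) (js : List (Fin k)) : Set where
    field
      i-same  : i σ′ ≡ i σ
      T-head  : T[ σ′ ] (i σ) ≡ T[ σ ] (i σ)
      T-≤     : ∀ x → T[ σ′ ] x ≤ T[ σ ] x
      relaxed : ∀ {j} → j ∈ js → T[ σ′ ] (i σ + a j) ≤ suc (T[ σ ] (i σ))
      sound   : Reach elements (T[ σ ] (i σ)) (i σ) → Sound σ → Sound σ′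
      cost    : assignments σ′ ≤ assignments σ + 2 * length js

  Scanned-[] : ∀ {σ} → Scanned σ σ []
  Scanned-[] = record
    { i-same  = refl
    ; T-head  = refl
    ; T-≤     = λ _ → ≤-refl
    ; relaxed = λ ()
    ; sound   = λ _ S → S
    ; cost    = m≤m+n _ 0
    }

  Scanned-∷ : ∀ {σ σ₁ σ₂ j js} → Scanned σ σ₁ (j ∷ []) → Scanned σ₁ σ₂ js → Scanned σ σ₂ (j ∷ js)
  Scanned-∷ {σ} {state T₁ U₁ i₁ c₁} {σ₂} {j} {js} p q with refl ← Scanned.i-same p = record
    { i-same  = q.i-same
    ; T-head  = trans q.T-head p.T-head
    ; T-≤     = λ x → ≤-trans (q.T-≤ x) (p.T-≤ x)
    ; relaxed = λ where
        (here refl)  → ≤-trans (q.T-≤ _) (p.relaxed (here refl))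
        (there j∈js) → ≤-trans (q.relaxed j∈js) (≤-reflexive (cong suc p.T-head))
    ; sound   = λ r S → q.sound (subst (λ t → Reach elements t (i σ)) (sym p.T-head) r) (p.sound r S)
    ; cost    = begin
        assignments σ₂                      ≤⟨ q.cost ⟩
        c₁ + 2 * length js                  ≤⟨ +-monoˡ-≤ _ p.cost ⟩
        assignments σ + 2 + 2 * length js   ≡⟨ lemma (assignments σ) (length js) ⟩
        assignments σ + 2 * suc (length js) ∎
    }
    where
    module p = Scanned p
    module q = Scanned q
    open ≤-Reasoning
    lemma : ∀ c n → c + 2 + 2 * n ≡ c + 2 * suc n
    lemma = solve-∀

  relax-Scanned : ∀ σ j → Scanned σ (relax σ j) (j ∷ [])
  relax-Scanned σ j = if-elim (λ σ′ → Scanned σ σ′ (j ∷ [])) (T[ σ ] p >? v) improve keep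
    where
    p = i σ + a j
    v = T[ σ ] (i σ) + 1
    σ′ = writeU p j (writeT p v σ)

    v≡ : v ≡ suc (T[ σ ] (i σ))
    v≡ = +-comm _ 1

    -- A stamp lies strictly between 0 and `size`, so the write misses the cell of `i σ`.
    p≢i : p &w ≢ i σ &w
    p≢i eq = <-irrefl (sym (&w-injective (i σ) (m≤m+n _ _) (i+a<i+size _ j) ≤-refl (m<m+n _ (>-nonZero⁻¹ size)) eq))
                      (i<i+a (i σ) j)

    keep : ¬ (T[ σ ] p > v) → Scanned σ σ (j ∷ [])
    keep T≯v = record
      { i-same  = refl
      ; T-head  = refl
      ; T-≤     = λ _ → ≤-refl
      ; relaxed = λ where (here refl) → ≤-trans (≮⇒≥ T≯v) (≤-reflexive v≡)
      ; sound   = λ _ S → S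
      ; cost    = m≤m+n _ 2
      }

    improve : T[ σ ] p > v → Scanned σ σ′ (j ∷ [])
    improve T>v = record
      { i-same  = refl
      ; T-head  = T-writeT-≢ σ v p≢i
      ; T-≤     = T-≤
      ; relaxed = λ where (here refl) → ≤-reflexive (trans (T-writeT-≡ σ v refl) v≡)
      ; sound   = sound
      ; cost    = ≤-reflexive (+-comm 2 (assignments σ))
      }
      where
      T-≤ : ∀ x → T[ σ′ ] x ≤ T[ σ ] x
      T-≤ x with p &w Fin.≟ x &w
      ... | yes p≡x = ≤-trans (≤-reflexive (T-writeT-≡ σ v p≡x))
                              (<⇒≤ (subst (λ y → v < lookup (T σ) y) p≡x T>v))
      ... | no  p≢x = ≤-reflexive (T-writeT-≢ σ v p≢x)

      sound : Reach elements (T[ σ ] (i σ)) (i σ) → Sound σ → Sound σ′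
      sound r S x i≤x x<i+size T≤s with p &w Fin.≟ x &w
      ... | no  p≢x = subst₂ (λ u t → EndsWith u t x)
                        (sym (U-writeU-≢ (writeT p v σ) j p≢x)) (sym (T-writeT-≢ σ v p≢x))
                        (S x i≤x x<i+size (subst (_≤ s) (T-writeT-≢ σ v p≢x) T≤s))
      -- Within the window the written cell belongs to `p` alone.
      ... | yes p≡x with refl ← &w-injective (i σ) (m≤m+n (i σ) (a j)) (i+a<i+size (i σ) j) i≤x x<i+size p≡x =
        subst₂ (λ u t → EndsWith u t p)
          (sym (U-writeU-≡ (writeT p v σ) {p} j refl)) (sym (trans (T-writeT-≡ σ {p} v refl) v≡)) (add r j)

  foldl-Scanned : ∀ σ js → Scanned σ (List.foldl relax σ js) js
  foldl-Scanned σ []       = Scanned-[]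
  foldl-Scanned σ (j ∷ js) = Scanned-∷ (relax-Scanned σ j) (foldl-Scanned (relax σ j) js)

  ∈-indicesFrom : ∀ {u j} → u Fin.≤ j → j ∈ indicesFrom u
  ∈-indicesFrom {u} {j} = ∈-filter⁺ (u Fin.≤?_) (∈-allFin j)

  length-indicesFrom≤k : ∀ u → length (indicesFrom u) ≤ k
  length-indicesFrom≤k u = ≤-trans (length-filter (u Fin.≤?_) (List.allFin k))
                                   (≤-reflexive (length-tabulate {n = k} (λ j → j)))

  -- The loop invariant and its preservation.

  -- `complete` needs no upper bound on `x`, as a candidate is always below `i σ + size`. `reached`
  -- keeps the representability of past heads, whose cells have been cleared.
  record Invariant (σ : State) : Set where
    field
      sound    : Sound σ
      complete : ∀ {t x} → i σ ≤ x → Candidate (i σ) t x → T[ σ ] x ≤ t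
      reached  : ∀ {x} → x < i σ → ∃[ t ] (t ≤ s × Reach elements t x)
      cost     : assignments σ ≤ size + size + i σ * (1 + 2 * k)

    head-complete : ∀ {t} → Reach elements t (i σ) → T[ σ ] (i σ) ≤ t
    head-complete r = complete ≤-refl (Reach⇒Candidate r)

    head-EndsWith : T[ σ ] (i σ) ≤ s → EndsWith (U[ σ ] (i σ)) (T[ σ ] (i σ)) (i σ)
    head-EndsWith = sound (i σ) ≤-refl (m<m+n _ (>-nonZero⁻¹ size))

    head-Reach : T[ σ ] (i σ) ≤ s → Reach elements (T[ σ ] (i σ)) (i σ)
    head-Reach T≤s = EndsWith⇒Reach (head-EndsWith T≤s)

  initial-Invariant : Invariant initial
  initial-Invariant = record
    { sound    = sound
    ; complete = λ where _ none → ≤-reflexive T[0]≡0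
    ; reached  = λ ()
    ; cost     = m≤m+n _ 0
    }
    where
    -- Writing 0 for the integer 0 in `blank` yields the `T` of `initial`, so the lemmas on `writeT`
    -- apply.
    blank : State
    blank = state (replicate size (s + 1)) (replicate size first) 0 0

    T[0]≡0 : T[ initial ] 0 ≡ 0
    T[0]≡0 = T-writeT-≡ blank {0} 0 refl

    sound : Sound initial
    sound x 0≤x x<size T≤s with 0 &w Fin.≟ x &w
    ... | no 0≢x = contradiction T≤s (<⇒≱ (subst (s <_)
                     (sym (trans (T-writeT-≢ blank 0 0≢x) (lookup-replicate (x &w) (s + 1))))
                     (m<m+n s (s≤s z≤n))))
    ... | yes 0≡x with refl ← &w-injective 0 z≤n (>-nonZero⁻¹ size) 0≤x x<size 0≡x =
      subst₂ (λ u t → EndsWith u t 0) (sym (lookup-replicate (0 &w) first)) (sym T[0]≡0) none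

  -- Stated for any `σ′` with `Scanned` instead of `scan σ`, so that `i′` is a variable and `i-same`
  -- can be matched with `refl`.
  advance : ∀ {σ σ′} → Invariant σ → T[ σ ] (i σ) ≤ s → Scanned σ σ′ (indicesFrom (U[ σ ] (i σ))) →
            Invariant (increment (clear σ′))
  advance {σ} {σ′@(state T′ U′ i′ c′)} inv head≤s sc with refl ← Scanned.i-same sc = record
    { sound    = sound
    ; complete = λ i<x c → subst (_≤ _) (sym (T-clear-≢ (i<x , c))) (complete i<x c)
    ; reached  = reached
    ; cost     = cost
    }
    where
    module inv = Invariant inv
    module sc = Scanned sc
    τ = increment (clear σ′)
    u = U[ σ ] (i σ)

    sound : Sound τ
    sound x i<x x<1+i+size T≤s with i σ &w Fin.≟ x &w
    ... | yes i≡x = contradiction T≤s (<⇒≱ (subst (s <_) (sym (T-writeT-≡ σ′ (s + 1) i≡x)) (m<m+n s (s≤s z≤n))))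
    ... | no  i≢x = subst (λ t → EndsWith (U[ σ′ ] x) t x) (sym (T-writeT-≢ σ′ (s + 1) i≢x))
                      (sc.sound (inv.head-Reach head≤s) inv.sound x (<⇒≤ i<x) x<i+size
                        (subst (_≤ s) (T-writeT-≢ σ′ (s + 1) i≢x) T≤s))
      where
      x<i+size : x < i σ + size
      -- The integer `i σ + size` entering the window shares the cell just cleared, which `i≢x`
      -- excludes.
      x<i+size = ≤∧≢⇒< (≤-pred x<1+i+size) λ where refl → i≢x ([i+size]&w≡i&w (i σ))

    -- A candidate is less than `size` above some `y ≤ i σ`, so clearing the cell of `i σ` does not
    -- affect it.
    T-clear-≢ : ∀ {t x} → i σ < x × Candidate (suc (i σ)) t x → T[ τ ] x ≡ T[ σ′ ] x
    T-clear-≢ (i<x , add {x = y} y<1+i r j) = T-writeT-≢ σ′ (s + 1) λ i≡x →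
      <-irrefl (&w-injective (i σ) ≤-refl (m<m+n _ (>-nonZero⁻¹ size)) (<⇒≤ i<x)
                 (<-≤-trans (i+a<i+size y j) (+-monoˡ-≤ size (≤-pred y<1+i))) i≡x)
               i<x

    relaxed : ∀ j → T[ σ′ ] (i σ + a j) ≤ suc (T[ σ ] (i σ))
    relaxed j with u Fin.≤? j
    ... | yes u≤j = sc.relaxed (∈-indicesFrom u≤j)
    -- For a skipped index the exchange gives the bound before the scan, and the scan only lowers
    -- entries.
    ... | no  u≰j = ≤-trans (sc.T-≤ _)
                      (inv.complete (m≤m+n _ _) (skipped-Candidate (inv.head-EndsWith head≤s) (≰⇒> u≰j)))

    complete : ∀ {t x} → i σ < x → Candidate (suc (i σ)) t x → T[ σ′ ] x ≤ t
    complete i<x (add {x = y} y<1+i r j) with m≤n⇒m<n∨m≡n (≤-pred y<1+i)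
    ... | inj₁ y<i  = ≤-trans (sc.T-≤ _) (inv.complete (<⇒≤ i<x) (add y<i r j))
    -- The new candidates start from `i σ` itself, whose entry is already minimal.
    ... | inj₂ refl = ≤-trans (relaxed j) (s≤s (inv.head-complete r))

    reached : ∀ {x} → x < suc (i σ) → ∃[ t ] (t ≤ s × Reach elements t x)
    reached x<1+i with m≤n⇒m<n∨m≡n (≤-pred x<1+i)
    ... | inj₁ x<i  = inv.reached x<i
    ... | inj₂ refl = T[ σ ] (i σ) , head≤s , inv.head-Reach head≤s

    cost : suc c′ ≤ size + size + suc (i σ) * (1 + 2 * k)
    cost = begin
      suc c′                                              ≤⟨ s≤s sc.cost ⟩
      suc (assignments σ + 2 * length (indicesFrom u))    ≤⟨ s≤s (+-mono-≤ inv.cost (*-monoʳ-≤ 2 (length-indicesFrom≤k u))) ⟩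
      suc (size + size + i σ * (1 + 2 * k) + 2 * k)       ≡⟨ lemma (size + size) (i σ * (1 + 2 * k)) (2 * k) ⟩
      size + size + suc (i σ) * (1 + 2 * k)               ∎
      where
      open ≤-Reasoning
      lemma : ∀ p q r → suc (p + q + r) ≡ p + (suc r + q)
      lemma = solve-∀

  scan-Scanned : ∀ σ → Scanned σ (scan σ) (indicesFrom (U[ σ ] (i σ)))
  scan-Scanned σ = foldl-Scanned σ (indicesFrom (U[ σ ] (i σ)))

  body-Invariant : ∀ {σ} → Invariant σ → T[ σ ] (i σ) ≤ s → Invariant (body σ)
  body-Invariant {σ} inv head≤s = advance inv head≤s (scan-Scanned σ)

  -- Termination, the returned value and the number of writes.

  -- While the head entry is at most `s`, `i σ` is a sum of at most `s` stamps, hence at most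
  -- `s * max-element A`; the fuel cannot run out before the head exceeds `s`.
  terminates : ∀ fuel {σ} → Invariant σ → T[ σ ] (i σ) ≤ s → s * max-element A < i σ + fuel →
               ∃[ τ ] (σ ⇓ τ × Invariant τ × T[ τ ] (i τ) > s)
  terminates zero {σ} inv head≤s bound = contradiction
    (≤-trans (Reach⇒≤ A (Invariant.head-Reach inv head≤s)) (*-monoˡ-≤ _ head≤s))
    (<⇒≱ (subst (s * max-element A <_) (+-identityʳ (i σ)) bound))
  terminates (suc fuel) {σ} inv head≤s bound with T[ body σ ] (i (body σ)) ≤? s
  ... | no  head≰s′ = body σ , exit (≰⇒> head≰s′) , body-Invariant inv head≤s , ≰⇒> head≰s′
  ... | yes head≤s′ =
    let τ , run , inv′ , T>s = terminates fuel (body-Invariant inv head≤s) head≤s′ bound′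
    in τ , repeat head≤s′ run , inv′ , T>s
    where
    bound′ : s * max-element A < i (body σ) + fuel
    bound′ = subst (s * max-element A <_) (trans (+-suc (i σ) fuel)
                                 (cong (λ n → suc n + fuel) (sym (Scanned.i-same (scan-Scanned σ))))) bound

  T[0]≤s : T[ initial ] 0 ≤ s
  T[0]≤s = ≤-trans (Invariant.head-complete initial-Invariant none) z≤n

  correct : ∃[ n ] ∃[ c ] (Returns n After c Assignments × IsRange s A n
                           × c ≤ size + size + suc n * (1 + 2 * k))
  correct with terminates (suc (s * max-element A)) initial-Invariant T[0]≤s ≤-refl
  -- At `i = 0` the empty sum would force a head entry of 0, so the final `i` is a successor and
  -- `i τ ∸ 1` is exact.
  ... | state _ _ zero _ , _ , inv , T>s =
        contradiction (≤-trans (Invariant.head-complete inv none) z≤n) (<⇒≱ T>s)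
  ... | τ@(state _ _ (suc n) c) , run , inv , T>s =
        n , c , (τ , run , refl , refl) , (representable , maximal) , Invariant.cost inv
    where
    representable : AllRepresentable s A n
    representable x x≤n with t , t≤s , r ← Invariant.reached inv (s≤s x≤n) = Reach⇒Representable A r t≤s

    maximal : ∀ m → AllRepresentable s A m → m ≤ n
    -- If `n < m`, then `suc n` is a sum of at most `s` stamps, and completeness contradicts the
    -- exit condition.
    maximal m rep = ≮⇒≥ λ n<m →
      let t , t≤s , r = Representable⇒Reach A (rep (suc n) n<m)
      in <⇒≱ T>s (≤-trans (Invariant.head-complete inv r) t≤s)

proposition16 : ∃[ C ] ∃[ D ]
    ((k s : ℕ) .{{_ : NonZero k}} .{{_ : NonZero s}} (A : Basis k) →
    min-element A ≡ 1 →
    let open SlidingWindow A s in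
    ∃[ n ] ∃[ c ]
    (Returns n After c Assignments
    × IsRange s A n
    × c ≤ C * (k * s * max-element A)
    × c ≤ D * (k * n + max-element A)))
-- Write `M` for the largest element. The two arrays cost at most `4 * M`, and `suc n` rounds at
-- most `3 * k` each, as `1 ≤ k`. The surplus `3 * k` is at most `3 * M`, which makes 7. Since
-- `k * n` and `M` are both at most `k * s * M`, the coarse constant is twice that.
proposition16 = 14 , 7 , λ k s A _ →
  let n , c , returns , range , cost = Correctness.correct A s
      M = max-element A
      open ≤-Reasoning

      size≤2*M = 2^⌈log₂[m+1]⌉≤2*m (Basis.positive A last)

      n≤s*M : n ≤ s * M
      n≤s*M = let t , t≤s , r = Representable⇒Reach A (proj₁ range n ≤-refl)
              in ≤-trans (Reach⇒≤ A r) (*-monoˡ-≤ M t≤s)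

      sharp : c ≤ 7 * (k * n + M)
      sharp = begin
        c                                          ≤⟨ cost ⟩
        _ + suc n * (1 + 2 * k)                    ≤⟨ +-mono-≤ (+-mono-≤ size≤2*M size≤2*M)
                                                        (*-monoʳ-≤ (suc n) (+-monoˡ-≤ (2 * k) (>-nonZero⁻¹ k))) ⟩
        2 * M + 2 * M + suc n * (k + 2 * k)        ≡⟨ regroup M n k ⟩
        4 * M + 3 * (k * n) + 3 * k                ≤⟨ +-mono-≤ (+-monoʳ-≤ (4 * M) (*-monoˡ-≤ (k * n) (m≤m+n 3 4)))
                                                        (*-monoʳ-≤ 3 (k≤max-element A)) ⟩
        4 * M + 7 * (k * n) + 3 * M                ≡⟨ collect M (k * n) ⟩
        7 * (k * n + M)                            ∎

      k*n≤k*s*M = ≤-trans (*-monoʳ-≤ k n≤s*M) (≤-reflexive (sym (*-assoc k s M)))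
      M≤k*s*M   = m≤n*m M (k * s) {{m*n≢0 k s}}

      coarse : c ≤ 14 * (k * s * M)
      coarse = begin
        c                            ≤⟨ sharp ⟩
        7 * (k * n + M)              ≤⟨ *-monoʳ-≤ 7 (+-mono-≤ k*n≤k*s*M M≤k*s*M) ⟩
        7 * (k * s * M + k * s * M)  ≡⟨ double (k * s * M) ⟩
        14 * (k * s * M)             ∎
  in n , c , returns , range , coarse , sharp
  where
  regroup : ∀ M n k → 2 * M + 2 * M + suc n * (k + 2 * k) ≡ 4 * M + 3 * (k * n) + 3 * k
  regroup = solve-∀
  collect : ∀ M p → 4 * M + 7 * p + 3 * M ≡ 7 * (p + M)
  collect = solve-∀
  double : ∀ p → 7 * (p + p) ≡ 14 * p
  double = solve-∀
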